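{- A graph $G$ satisfies $\overline{\mu_\alpha}(G)\le 1$ if and only if $G$ is $\{\text{claw}, 2P_3\}$-free.
   Context: All graphs are finite, simple and undirected. For a graph $G$, $\alpha(G)$ is the maximum size of an independent set and $i(G)$ is the minimum size of a maximal (with respect to inclusion) independent set; the independence gap is $\mu_\alpha(G)=\alpha(G)-i(G)$. The hereditary independence gap is $\overline{\mu_\alpha}(G)=\max\{\mu_\alpha(H): H \text{ an induced subgraph of } G\}$. The claw is $K_{1,3}$; $P_3$ is the path on 3 vertices and $2P_3$ is the disjoint union of two copies of $P_3$. For a set $\mathcal F$ of graphs, $G$ is $\mathcal F$-free if no induced subgraph of $G$ is isomorphic to a member of $\mathcal F$. -}

module Defs where

open import Data.Bool.Properties using () renaming (_≟_ to _≟ᵇ_)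
open import Data.Fin.Base using (Fin; zero; suc; toℕ; splitAt)
open import Data.Fin.Properties using (all?)
open import Data.Fin.Subset using (Subset; inside; outside; _∈_; _⊂_; ∣_∣)
open import Data.Fin.Subset.Properties using (_∈?_; _⊂?_; anySubset?)
open import Data.List.Base using (List; []; _∷_; [_]; _++_; map; filter)
open import Data.List.Extrema.Nat using (max; min)
open import Data.List.Membership.Propositional using () renaming (_∈_ to _∈ˡ_)
open import Data.List.Membership.Propositional.Properties using (∈-map⁺; ∈-++⁺ˡ; ∈-++⁺ʳ)
open import Data.List.Relation.Unary.Any using (Any; here)
open import Data.Nat.Base using (ℕ; suc; _+_; _∸_; _<ᵇ_)
open import Data.Nat.Properties using (_≟_; 1+n≢n)
open import Data.Product.Base using (∃-syntax; _×_)
open import Data.Sum.Base using (_⊎_; inj₁; inj₂; swap; reduce)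
open import Data.Sum.Relation.Binary.Pointwise using (Pointwise; inj₁; inj₂; ⊎-symmetric; ⊎-decidable)
open import Data.Vec.Base using ([]; _∷_)
open import Function.Base using (_on_)
open import Function.Bundles using (_↔_; _⇔_; Inverse)
open import Level using (0ℓ)
open import Relation.Binary.Core using (Rel)
open import Relation.Binary.Definitions using (Symmetric; Irreflexive; Decidable)
open import Relation.Binary.PropositionalEquality using (_≡_; _≢_; refl; ≢-sym)
open import Relation.Nullary using (¬_; ¬?; _×-dec_; _⊎-dec_; _→-dec_)
import Relation.Unary as U

-- Adjacency is required to be decidable; classically this is no restriction,
-- and it makes the graph parameters below computable.
record Graph : Set₁ where
  infix 4 _~_ _~?_
  field
    order    : ℕ
    _~_      : Rel (Fin order) 0ℓ
    ~-sym    : Symmetric _~_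
    ~-irrefl : Irreflexive _≡_ _~_
    _~?_     : Decidable _~_

  Vertex : Set
  Vertex = Fin order

open Graph using (order)

infix 4 _≅_

record _≅_ (G H : Graph) : Set where
  private
    module G = Graph G
    module H = Graph H
  field
    vertices : G.Vertex ↔ H.Vertex
    adjacent : ∀ u v → u G.~ v ⇔ (Inverse.to vertices u H.~ Inverse.to vertices v)

-- The increasing enumeration of the elements of a subset.
element : ∀ {n} (S : Subset n) → Fin ∣ S ∣ → Fin n
element (inside  ∷ S) zero    = zero
element (inside  ∷ S) (suc i) = suc (element S i)
element (outside ∷ S) i       = suc (element S i)

induced : (G : Graph) → Subset (order G) → Graph
induced G S = record
  { order    = ∣ S ∣
  ; _~_      = _~_ on element S
  ; ~-sym    = ~-sym
  ; ~-irrefl = λ { refl → ~-irrefl refl }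
  ; _~?_     = λ u v → element S u ~? element S v
  } where open Graph G

infix 4 _isFreeOf_

_isFreeOf_ : Graph → List Graph → Set₁
G isFreeOf 𝓕 = ∀ S → ¬ Any (induced G S ≅_) 𝓕

subsets : ∀ n → List (Subset n)
subsets 0       = [ [] ]
subsets (suc n) = map (inside ∷_) (subsets n) ++ map (outside ∷_) (subsets n)

subsets-complete : ∀ {n} (S : Subset n) → S ∈ˡ subsets n
subsets-complete []            = here refl
subsets-complete (inside  ∷ S) = ∈-++⁺ˡ (∈-map⁺ (inside ∷_) (subsets-complete S))
subsets-complete (outside ∷ S) =
  ∈-++⁺ʳ (map (inside ∷_) (subsets _)) (∈-map⁺ (outside ∷_) (subsets-complete S))

module _ (G : Graph) where
  open Graph G using (_~_; _~?_)

  Independent : Subset (order G) → Set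
  Independent S = ∀ u v → u ∈ S → v ∈ S → ¬ (u ~ v)

  MaximalIndependent : Subset (order G) → Set
  MaximalIndependent S = Independent S × ¬ (∃[ T ] Independent T × S ⊂ T)

  independent? : U.Decidable Independent
  independent? S =
    all? λ u → all? λ v → (u ∈? S) →-dec ((v ∈? S) →-dec ¬? (u ~? v))

  maximalIndependent? : U.Decidable MaximalIndependent
  maximalIndependent? S =
    independent? S ×-dec ¬? (anySubset? λ T → independent? T ×-dec (S ⊂? T))

  -- The first argument of max or min takes part in the extremum.  In α and i
  -- it has no effect: sizes lie between 0 and the order of G, and both lists
  -- are nonempty, since the empty set is independent and every independent
  -- set extends to a maximal one.
  α : ℕ
  α = max 0 (map ∣_∣ (filter independent? (subsets (order G))))

  i : ℕ
  i = min (order G) (map ∣_∣ (filter maximalIndependent? (subsets (order G))))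

  -- Truncated subtraction is exact here, as i ≤ α.
  gap : ℕ
  gap = α ∸ i

hereditaryGap : Graph → ℕ
hereditaryGap G = max 0 (map (λ S → gap (induced G S)) (subsets (order G)))

path : ℕ → Graph
path n = record
  { order    = n
  ; _~_      = λ u v → suc (toℕ u) ≡ toℕ v ⊎ suc (toℕ v) ≡ toℕ u
  ; ~-sym    = swap
  ; ~-irrefl = λ { refl p → 1+n≢n (reduce p) }
  ; _~?_     = λ u v → (suc (toℕ u) ≟ toℕ v) ⊎-dec (suc (toℕ v) ≟ toℕ u)
  }

-- The parts are the first m and the last n vertices.
completeBipartite : ℕ → ℕ → Graph
completeBipartite m n = record
  { order    = m + n
  ; _~_      = λ u v → (toℕ u <ᵇ m) ≢ (toℕ v <ᵇ m)
  ; ~-sym    = ≢-sym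
  ; ~-irrefl = λ { refl p → p refl }
  ; _~?_     = λ u v → ¬? ((toℕ u <ᵇ m) ≟ᵇ (toℕ v <ᵇ m))
  }

disjointUnion : Graph → Graph → Graph
disjointUnion G H = record
  { order    = order G + order H
  ; _~_      = Pointwise G._~_ H._~_ on splitAt (order G)
  ; ~-sym    = ⊎-symmetric G.~-sym H.~-sym
  ; ~-irrefl = λ { {u} refl → irrefl (splitAt (order G) u) }
  ; _~?_     = λ u v → ⊎-decidable G._~?_ H._~?_ (splitAt (order G) u) (splitAt (order G) v)
  } where
  module G = Graph G
  module H = Graph H

  irrefl : ∀ x → ¬ Pointwise G._~_ H._~_ x x
  irrefl (inj₁ u) (inj₁ u~u) = G.~-irrefl refl u~u
  irrefl (inj₂ v) (inj₂ v~v) = H.~-irrefl refl v~v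

claw : Graph
claw = completeBipartite 1 3

2P₃ : Graph
2P₃ = disjointUnion (path 3) (path 3)

{-# OPTIONS --safe #-}
module Submission where

-- If an induced subgraph has gap at least 2, it contains an independent set A
-- and a maximal independent set B with |B| + 2 ≤ |A|.  Every vertex of A is in
-- B or has a neighbour in B, so by the pigeonhole principle two vertices a₁, a₂
-- of A have a common neighbour b in B.  In a claw-free graph b has no further
-- neighbour in A, hence every vertex of A - a₁ - a₂ is in B - b or has a
-- neighbour there; since these sets still satisfy |B - b| < |A - a₁ - a₂|, the
-- pigeonhole principle gives a second path a₃ b′ a₄.  By claw-freeness again
-- there is no edge between the two paths, so they induce 2P₃.
--
-- Conversely, the claw and 2P₃ have gaps 3 ∸ 1 and 4 ∸ 2.

open import Data.Fin.Base using (Fin; zero; suc; toℕ; splitAt; join)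
open import Data.Fin.Properties using (_≟_; any?; pigeonhole; join-splitAt; suc-injective)
open import Data.Fin.Subset
  using (Subset; inside; outside; _∈_; _∉_; _-_; _∪_; ⁅_⁆; ∣_∣)
open import Data.Fin.Subset.Properties
  using ( _∈?_; x∈p∪q⁻; p⊆p∪q; q⊆p∪q; x∈⁅x⁆; x∈⁅y⁆⇒x≡y; p─⊥≡p; p─q⊆p
        ; x∈p∧x≢y⇒x∈p-y; x∈p⇒∣p-x∣<∣p∣; ∣p∣≤n)
open import Data.List.Base using ([]; _∷_; map; filter)
open import Data.List.Extrema.Nat
  using (argmax-sel; argmin-sel; max≤v⁺; xs≤max; min≤xs)
open import Data.List.Membership.Propositional using () renaming (_∈_ to _∈ˡ_)
open import Data.List.Membership.Propositional.Properties
  using (∈-map⁺; ∈-map⁻; ∈-filter⁺; ∈-filter⁻)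
import Data.List.Relation.Unary.All as List using (lookup; universal)
open import Data.List.Relation.Unary.All.Properties using () renaming (map⁺ to All-map⁺)
open import Data.List.Relation.Unary.Any as Any using (here; there)
open import Data.Nat.Base using (ℕ; suc; _+_; _∸_; _≤_; _<_; z≤n; s≤s; s≤s⁻¹)
open import Data.Nat.Properties
  using ( ≤-reflexive; ≤-trans; ≤-antisym; <-≤-trans; n<1+n; n≤1+n; n≮n; n≮0; ≮⇒≥; ≰⇒>; _≤?_
        ; +-monoˡ-≤; ∸-mono; m≤n⇒m≤1+n; m≤n⇒m∸n≡0; m∸n≢0⇒n<m; m∸n+n≡m; 0∸n≡0; <⇒≤; <⇒≢
        ; module ≤-Reasoning)
open import Data.Product.Base using (∃-syntax; _×_; _,_; proj₁; proj₂)
open import Data.Sum.Base using (_⊎_; inj₁; inj₂; [_,_]′)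
open import Data.Sum.Relation.Binary.Pointwise using (Pointwise; inj₁; inj₂)
open import Data.Vec.Base using (Vec; []; _∷_; here; there; lookup; tabulate)
open import Data.Vec.Properties using (lookup∘tabulate; lookup⇒[]=; []=⇒lookup)
open import Data.Vec.Relation.Unary.All using (All; []; _∷_)
open import Data.Vec.Relation.Unary.All.Properties using (lookup⁺)
open import Data.Vec.Relation.Unary.AllPairs using ([]; _∷_)
open import Data.Vec.Relation.Unary.Unique.Propositional using (Unique)
open import Data.Vec.Relation.Unary.Unique.Propositional.Properties using (lookup-injective)
open import Function.Base using (_∘_)
open import Function.Bundles using (_⇔_; mk⇔; mk↔ₛ′; Inverse; Equivalence)
open import Function.Definitions using (Injective)
open import Level using (0ℓ)
open import Relation.Binary.PropositionalEquality
open import Relation.Nullary using (¬_; does; yes; no; contradiction; _×-dec_)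
open import Relation.Nullary.Decidable using (dec-true)
open import Relation.Unary using (Pred; Decidable)
open import Defs

open Graph using (order; Vertex)

private variable
  n : ℕ
  G K : Graph

-- Subsets of Fin n

module _ {P : Pred (Fin n) 0ℓ} (P? : Decidable P) where

  comprehension : Subset n
  comprehension = tabulate (does ∘ P?)

  ∈-comprehension⁺ : ∀ {x} → P x → x ∈ comprehension
  ∈-comprehension⁺ {x} px =
    lookup⇒[]= x comprehension (trans (lookup∘tabulate _ x) (dec-true (P? x) px))

  ∈-comprehension⁻ : ∀ {x} → x ∈ comprehension → P x
  ∈-comprehension⁻ {x} x∈ with P? x | trans (sym (lookup∘tabulate (does ∘ P?) x)) ([]=⇒lookup x∈)
  ... | yes px | _  = px
  ... | no  _  | ()

element-∈ : (S : Subset n) → ∀ i → element S i ∈ S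
element-∈ (inside  ∷ S) zero    = here
element-∈ (inside  ∷ S) (suc i) = there (element-∈ S i)
element-∈ (outside ∷ S) i       = there (element-∈ S i)

element-injective : (S : Subset n) → Injective _≡_ _≡_ (element S)
element-injective (inside  ∷ S) {zero}  {zero}  _  = refl
element-injective (inside  ∷ S) {suc _} {suc _} eq =
  cong suc (element-injective S (suc-injective eq))
element-injective (outside ∷ S) eq = element-injective S (suc-injective eq)

element-surjective : (S : Subset n) → ∀ {x} → x ∈ S → ∃[ i ] element S i ≡ x
element-surjective (inside  ∷ S) {zero}  _ = zero , refl
element-surjective (inside  ∷ S) {suc _} (there x∈S)
  with i , refl ← element-surjective S x∈S = suc i , refl
element-surjective (outside ∷ S) {suc _} (there x∈S)
  with i , refl ← element-surjective S x∈S = i , refl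

x∉p-x : (p : Subset n) → ∀ x → x ∉ p - x
x∉p-x (_ ∷ p) (suc x) (there x∈) = x∉p-x p x x∈

∣p∣≤1+∣p-x∣ : (p : Subset n) → ∀ x → ∣ p ∣ ≤ suc ∣ p - x ∣
∣p∣≤1+∣p-x∣ (inside  ∷ p) zero    = s≤s (≤-reflexive (cong ∣_∣ (sym (p─⊥≡p p))))
∣p∣≤1+∣p-x∣ (outside ∷ p) zero    = m≤n⇒m≤1+n (≤-reflexive (cong ∣_∣ (sym (p─⊥≡p p))))
∣p∣≤1+∣p-x∣ (inside  ∷ p) (suc x) = s≤s (∣p∣≤1+∣p-x∣ p x)
∣p∣≤1+∣p-x∣ (outside ∷ p) (suc x) = ∣p∣≤1+∣p-x∣ p x

module _ (p : Subset n) {x y z : Fin n} where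

  p-x-y⊆p : z ∈ p - x - y → z ∈ p
  p-x-y⊆p = p─q⊆p p ⁅ x ⁆ ∘ p─q⊆p (p - x) ⁅ y ⁆

  z∈p-x-y⇒z≢x : z ∈ p - x - y → z ≢ x
  z∈p-x-y⇒z≢x z∈ refl = x∉p-x p x (p─q⊆p (p - x) ⁅ y ⁆ z∈)

  z∈p-x-y⇒z≢y : z ∈ p - x - y → z ≢ y
  z∈p-x-y⇒z≢y z∈ refl = x∉p-x (p - x) y z∈

-- Deleting `z` takes one element from `q`, while deleting `x` and `y` takes at most two from `p`. A
-- surplus of two thus leaves the surplus of one that a second use of the pigeonhole principle
-- requires.
∣q-z∣<∣p-x-y∣ : (p q : Subset n) → 2 + ∣ q ∣ ≤ ∣ p ∣ → ∀ x y {z} → z ∈ q → ∣ q - z ∣ < ∣ p - x - y ∣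
∣q-z∣<∣p-x-y∣ p q 2+q≤p x y {z} z∈q = s≤s⁻¹ (s≤s⁻¹ (begin
  3 + ∣ q - z ∣      ≤⟨ s≤s (s≤s (x∈p⇒∣p-x∣<∣p∣ z∈q)) ⟩
  2 + ∣ q ∣          ≤⟨ 2+q≤p ⟩
  ∣ p ∣              ≤⟨ ∣p∣≤1+∣p-x∣ p x ⟩
  1 + ∣ p - x ∣      ≤⟨ s≤s (∣p∣≤1+∣p-x∣ (p - x) y) ⟩
  2 + ∣ p - x - y ∣  ∎))
  where open ≤-Reasoning

subset-pigeonhole : ∀ {m n} {S : Subset m} {T : Subset n} {R : Fin m → Fin n → Set} →
  ∣ T ∣ < ∣ S ∣ → (∀ x → x ∈ S → ∃[ y ] y ∈ T × R x y) →
  ∃[ x ] ∃[ x′ ] ∃[ y ] x ∈ S × x′ ∈ S × y ∈ T × x ≢ x′ × R x y × R x′ y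
subset-pigeonhole {S = S} {T} {R} T<S choice
  with i , j , i<j , eq ← pigeonhole T<S
         (λ i → proj₁ (element-surjective T (proj₁ (proj₂ (choice (element S i) (element-∈ S i))))))
  -- Abstracting the chosen values and then their indices turns `eq` into `k ≡ k′`, so matching on
  -- it identifies the two choices.
  with choice (element S i) (element-∈ S i) | choice (element S j) (element-∈ S j)
... | y , y∈T , Riy | y′ , y′∈T , Rjy′
  with k , refl ← element-surjective T y∈T | k′ , refl ← element-surjective T y′∈T
  with refl ← eq
  = element S i , element S j , y , element-∈ S i , element-∈ S j , y∈T
  , (λ e → <⇒≢ i<j (cong toℕ (element-injective S e))) , Riy , Rjy′

-- If `T` were smaller, the pigeonhole principle for the graph of `f` would give two distinct
-- elements with the same value.
injection⇒∣∣≤ : ∀ {m n} {S : Subset m} {T : Subset n} {f : Fin m → Fin n} →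
  Injective _≡_ _≡_ f → (∀ {x} → x ∈ S → f x ∈ T) → ∣ S ∣ ≤ ∣ T ∣
injection⇒∣∣≤ {f = f} f-inj f∈ = ≮⇒≥ λ T<S →
  let x , x′ , y , _ , _ , _ , x≢x′ , fx≡y , fx′≡y =
        subset-pigeonhole {R = λ x y → f x ≡ y} T<S (λ x x∈S → f x , f∈ x∈S , refl)
  in x≢x′ (f-inj (trans fx≡y (sym fx′≡y)))

-- Maximal independent sets and the gap

module _ (G : Graph) where
  open Graph G using (_~_; _~?_; ~-sym; ~-irrefl)

  -- For independent sets this is equivalent to maximality, but it speaks of single vertices instead
  -- of larger sets, which suits both the pigeonhole argument and transport along isomorphisms.
  Dominating : Subset (order G) → Set
  Dominating S = ∀ v → v ∈ S ⊎ (∃[ u ] u ∈ S × v ~ u)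

  -- A vertex outside `S` without a neighbour in `S` could be added to `S`.
  maximal⇒dominating : ∀ {S} → MaximalIndependent G S → Dominating S
  maximal⇒dominating {S} (indS , maxS) v with v ∈? S | any? (λ u → (u ∈? S) ×-dec (v ~? u))
  ... | yes v∈S | _           = inj₁ v∈S
  ... | no _    | yes nbr     = inj₂ nbr
  ... | no v∉S  | no  no-nbr  = contradiction
    (S ∪ ⁅ v ⁆ , ind , (λ {_} → p⊆p∪q ⁅ v ⁆) , v , q⊆p∪q S ⁅ v ⁆ (x∈⁅x⁆ v) , v∉S) maxS
    where
    ind : Independent G (S ∪ ⁅ v ⁆)
    ind x y x∈ y∈ x~y with x∈p∪q⁻ S ⁅ v ⁆ x∈ | x∈p∪q⁻ S ⁅ v ⁆ y∈
    ... | inj₁ x∈S | inj₁ y∈S = indS x y x∈S y∈S x~y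
    ... | inj₁ x∈S | inj₂ y∈v rewrite x∈⁅y⁆⇒x≡y v y∈v = no-nbr (x , x∈S , ~-sym x~y)
    ... | inj₂ x∈v | inj₁ y∈S rewrite x∈⁅y⁆⇒x≡y v x∈v = no-nbr (y , y∈S , x~y)
    ... | inj₂ x∈v | inj₂ y∈v =
      ~-irrefl (trans (x∈⁅y⁆⇒x≡y v x∈v) (sym (x∈⁅y⁆⇒x≡y v y∈v))) x~y

  dominating⇒maximal : ∀ {S} → Independent G S → Dominating S → MaximalIndependent G S
  dominating⇒maximal {S} indS dom = indS , not-extendable
    where
    not-extendable : ¬ _
    not-extendable (T , indT , S⊆T , v , v∈T , v∉S) with dom v
    ... | inj₁ v∈S             = v∉S v∈S
    ... | inj₂ (u , u∈S , v~u) = indT v u v∈T (S⊆T u∈S) v~u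

  ∣∣∸∣∣≤gap : ∀ {A B} → Independent G A → MaximalIndependent G B → ∣ A ∣ ∸ ∣ B ∣ ≤ gap G
  ∣∣∸∣∣≤gap {A} {B} indA maxB = ∸-mono
    (List.lookup (xs≤max 0 _)
      (∈-map⁺ ∣_∣ (∈-filter⁺ (independent? G) (subsets-complete A) indA)))
    (List.lookup (min≤xs (order G) _)
      (∈-map⁺ ∣_∣ (∈-filter⁺ (maximalIndependent? G) (subsets-complete B) maxB)))

  -- Positivity excludes the default values of the extrema: `α` equal to 0, or `i` equal to the
  -- order of `G`, would make the truncated difference 0.
  gap-attained : 0 < gap G →
    ∃[ A ] ∃[ B ] Independent G A × MaximalIndependent G B × gap G ≡ ∣ A ∣ ∸ ∣ B ∣
  gap-attained 0<gap
    with argmax-sel (λ k → k) 0 (map ∣_∣ (filter (independent? G) (subsets (order G))))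
       | argmin-sel (λ k → k) (order G)
           (map ∣_∣ (filter (maximalIndependent? G) (subsets (order G))))
  ... | inj₁ α≡0 | _ = contradiction (subst (0 <_) gap≡0 0<gap) n≮0
    where
    gap≡0 : gap G ≡ 0
    gap≡0 = trans (cong (_∸ i G) α≡0) (0∸n≡0 (i G))
  ... | inj₂ α∈ | i-sel
    with A , A∈ , α≡ ← ∈-map⁻ ∣_∣ α∈
    with _ , indA ← ∈-filter⁻ (independent? G) {xs = subsets (order G)} A∈
    with i-sel
  ... | inj₁ i≡n = contradiction (subst (0 <_) gap≡0 0<gap) n≮0
    where
    gap≡0 : gap G ≡ 0
    gap≡0 = trans (cong₂ _∸_ α≡ i≡n) (m≤n⇒m∸n≡0 (∣p∣≤n A))
  ... | inj₂ i∈
    with B , B∈ , i≡ ← ∈-map⁻ ∣_∣ i∈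
    with _ , maxB ← ∈-filter⁻ (maximalIndependent? G) {xs = subsets (order G)} B∈
    = A , B , indA , maxB , cong₂ _∸_ α≡ i≡

-- Transfer of the gap along an isomorphism

module _ {K H : Graph} (K≅H : K ≅ H) where
  private
    module K = Graph K
    module H = Graph H
  open _≅_ K≅H
  open Inverse vertices using (to; from; strictlyInverseˡ; strictlyInverseʳ)

  preimage : Subset (order H) → Subset (order K)
  preimage T = comprehension (λ v → to v ∈? T)

  from-∈ : ∀ {T v} → v ∈ T → from v ∈ preimage T
  from-∈ {T} {v} v∈T =
    ∈-comprehension⁺ (λ v → to v ∈? T) (subst (_∈ T) (sym (strictlyInverseˡ v)) v∈T)

  to-∈ : ∀ {T v} → v ∈ preimage T → to v ∈ T
  to-∈ {T} = ∈-comprehension⁻ (λ v → to v ∈? T)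

  to-injective : Injective _≡_ _≡_ to
  to-injective {x} {y} eq =
    trans (sym (strictlyInverseʳ x)) (trans (cong from eq) (strictlyInverseʳ y))

  from-injective : Injective _≡_ _≡_ from
  from-injective {x} {y} eq =
    trans (sym (strictlyInverseˡ x)) (trans (cong to eq) (strictlyInverseˡ y))

  ∣preimage∣ : ∀ T → ∣ preimage T ∣ ≡ ∣ T ∣
  ∣preimage∣ T = ≤-antisym
    (injection⇒∣∣≤ to-injective to-∈) (injection⇒∣∣≤ from-injective from-∈)

  preimage-independent : ∀ {T} → Independent H T → Independent K (preimage T)
  preimage-independent indT u v u∈ v∈ u~v =
    indT (to u) (to v) (to-∈ u∈) (to-∈ v∈) (Equivalence.to (adjacent u v) u~v)

  preimage-dominating : ∀ {T} → Dominating H T → Dominating K (preimage T)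
  preimage-dominating {T} dom v with dom (to v)
  ... | inj₁ v∈T             = inj₁ (∈-comprehension⁺ (λ v → to v ∈? T) v∈T)
  ... | inj₂ (u , u∈T , v~u) = inj₂
    (from u , from-∈ u∈T
    , Equivalence.from (adjacent v (from u)) (subst (to v H.~_) (sym (strictlyInverseˡ u)) v~u))

  -- Sets attaining a positive gap of `H` pull back to sets of the same sizes in `K`, and maximality
  -- is carried across as domination. A gap of 0 is bounded trivially.
  gap-≅ : gap H ≤ gap K
  gap-≅ with 1 ≤? gap H
  ... | no  gap≯0 = ≤-trans (s≤s⁻¹ (≰⇒> gap≯0)) z≤n
  ... | yes gap>0 with A , B , indA , maxB , gap≡ ← gap-attained H gap>0 = begin
    gap H                              ≡⟨ gap≡ ⟩
    ∣ A ∣ ∸ ∣ B ∣                      ≡⟨ cong₂ _∸_ (∣preimage∣ A) (∣preimage∣ B) ⟨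
    ∣ preimage A ∣ ∸ ∣ preimage B ∣    ≤⟨ ∣∣∸∣∣≤gap K (preimage-independent indA)
                                            (dominating⇒maximal K (preimage-independent (proj₁ maxB))
                                              (preimage-dominating (maximal⇒dominating H maxB))) ⟩
    gap K                              ∎
    where open ≤-Reasoning

-- The positive lower bound forces `o < n`, so the truncated subtraction is exact.
0<m≤n∸o⇒m+o≤n : ∀ {m n o} → 0 < m → m ≤ n ∸ o → m + o ≤ n
0<m≤n∸o⇒m+o≤n {m} {n} {o} 0<m m≤n∸o = begin
  m + o      ≤⟨ +-monoˡ-≤ o m≤n∸o ⟩
  n ∸ o + o  ≡⟨ m∸n+n≡m (<⇒≤ (m∸n≢0⇒n<m {n} {o} (≢-sym (<⇒≢ (<-≤-trans 0<m m≤n∸o))))) ⟩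
  n          ∎
  where open ≤-Reasoning

gap≤hereditaryGap : ∀ G S → gap (induced G S) ≤ hereditaryGap G
gap≤hereditaryGap G S = List.lookup (xs≤max 0 _) (∈-map⁺ _ (subsets-complete S))

-- Embeddings as induced subgraphs

¬⇔¬ : {P Q : Set} → ¬ P → ¬ Q → P ⇔ Q
¬⇔¬ ¬p ¬q = mk⇔ (λ p → contradiction p ¬p) (λ q → contradiction q ¬q)

infix 4 _↪_

record _↪_ (K G : Graph) : Set where
  private
    module K = Graph K
    module G = Graph G
  field
    to        : Vertex K → Vertex G
    injective : Injective _≡_ _≡_ to
    adjacent  : ∀ u v → u K.~ v ⇔ (to u G.~ to v)

↪-induced : ∀ G S → K ↪ induced G S → K ↪ G
↪-induced G S e = record
  { to        = element S ∘ to
  ; injective = injective ∘ element-injective S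
  ; adjacent  = adjacent
  } where open _↪_ e

module _ {K G : Graph} (e : K ↪ G) where
  open _↪_ e

  image : Subset (order G)
  image = comprehension (λ v → any? (λ u → to u ≟ v))

  private
    image⁻ : ∀ j → ∃[ u ] to u ≡ element image j
    image⁻ j = ∈-comprehension⁻ (λ v → any? (λ u → to u ≟ v)) (element-∈ image j)

    image⁺ : ∀ u → ∃[ j ] element image j ≡ to u
    image⁺ u = element-surjective image (∈-comprehension⁺ (λ v → any? (λ u → to u ≟ v)) (u , refl))

  -- The witnesses of membership in `image` define the map back to `K`; injectivity of `to` and of
  -- `element` makes the two maps mutually inverse.
  induced-image : induced G image ≅ K
  induced-image = record
    { vertices = mk↔ₛ′ (proj₁ ∘ image⁻) (proj₁ ∘ image⁺)
        (λ u → injective (trans (proj₂ (image⁻ _)) (proj₂ (image⁺ u))))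
        (λ j → element-injective image (trans (proj₂ (image⁺ _)) (proj₂ (image⁻ j))))
    ; adjacent = λ j k → mk⇔
        (λ j~k → Equivalence.from (adjacent _ _)
          (subst₂ (Graph._~_ G) (sym (proj₂ (image⁻ j))) (sym (proj₂ (image⁻ k))) j~k))
        (λ j~k → subst₂ (Graph._~_ G) (proj₂ (image⁻ j)) (proj₂ (image⁻ k))
          (Equivalence.to (adjacent _ _) j~k))
    }

isFreeOf⇒¬↪ : ∀ {𝓕} → G isFreeOf 𝓕 → K ∈ˡ 𝓕 → ¬ (K ↪ G)
isFreeOf⇒¬↪ free K∈𝓕 e =
  free (image e) (Any.map (λ { refl → induced-image e }) K∈𝓕)

-- Stars, paths and disjoint unions as induced subgraphs

module _ {G : Graph} where
  open Graph G using (_~_; ~-sym; ~-irrefl)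

  -- The independent set `A` supplies the non-edges between leaves, and irreflexivity separates the
  -- centre from its neighbours.
  star-↪ : ∀ {n A} c (leaves : Vec (Vertex G) n) → Independent G A →
    Unique leaves → All (_∈ A) leaves → All (c ~_) leaves → completeBipartite 1 n ↪ G
  star-↪ {n} c leaves indA unique leaves∈A c~leaves = record
    { to = to ; injective = injective ; adjacent = adjacent }
    where
    to : Fin (suc n) → Vertex G
    to = lookup (c ∷ leaves)

    injective : Injective _≡_ _≡_ to
    injective {zero}  {zero}  _  = refl
    injective {zero}  {suc j} eq = contradiction (lookup⁺ c~leaves j) (~-irrefl eq)
    injective {suc i} {zero}  eq = contradiction (lookup⁺ c~leaves i) (~-irrefl (sym eq))
    injective {suc i} {suc j} eq = cong suc (lookup-injective unique i j eq)

    adjacent : ∀ u v → Graph._~_ (completeBipartite 1 n) u v ⇔ (to u ~ to v)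
    adjacent zero    zero    = ¬⇔¬ (λ p → p refl) (~-irrefl refl)
    adjacent zero    (suc j) = mk⇔ (λ _ → lookup⁺ c~leaves j) (λ _ ())
    adjacent (suc i) zero    = mk⇔ (λ _ → ~-sym (lookup⁺ c~leaves i)) (λ _ ())
    adjacent (suc i) (suc j) = ¬⇔¬ (λ p → p refl)
      (indA _ _ (lookup⁺ leaves∈A i) (lookup⁺ leaves∈A j))

  -- Both edges are directed towards the midpoint `y`, the form in which `common-neighbour` yields
  -- them.
  path₃-↪ : ∀ {x y z} → x ≢ z → x ~ y → z ~ y → ¬ x ~ z → path 3 ↪ G
  path₃-↪ {x} {y} {z} x≢z x~y z~y x≁z = record
    { to        = lookup (x ∷ y ∷ z ∷ [])
    ; injective = lookup-injective
        (((λ e → ~-irrefl e x~y) ∷ x≢z ∷ []) ∷ ((λ e → ~-irrefl (sym e) z~y) ∷ []) ∷ [] ∷ []) _ _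
    ; adjacent  = adjacent
    }
    where
    adjacent : ∀ u v → Graph._~_ (path 3) u v ⇔
      (lookup (x ∷ y ∷ z ∷ []) u ~ lookup (x ∷ y ∷ z ∷ []) v)
    adjacent zero             zero             = ¬⇔¬ (λ { (inj₁ ()) ; (inj₂ ()) }) (~-irrefl refl)
    adjacent zero             (suc zero)       = mk⇔ (λ _ → x~y) (λ _ → inj₁ refl)
    adjacent zero             (suc (suc zero)) = ¬⇔¬ (λ { (inj₁ ()) ; (inj₂ ()) }) x≁z
    adjacent (suc zero)       zero             = mk⇔ (λ _ → ~-sym x~y) (λ _ → inj₂ refl)
    adjacent (suc zero)       (suc zero)       = ¬⇔¬ (λ { (inj₁ ()) ; (inj₂ ()) }) (~-irrefl refl)
    adjacent (suc zero)       (suc (suc zero)) = mk⇔ (λ _ → ~-sym z~y) (λ _ → inj₁ refl)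
    adjacent (suc (suc zero)) zero             = ¬⇔¬ (λ { (inj₁ ()) ; (inj₂ ()) }) (x≁z ∘ ~-sym)
    adjacent (suc (suc zero)) (suc zero)       = mk⇔ (λ _ → z~y) (λ _ → inj₂ refl)
    adjacent (suc (suc zero)) (suc (suc zero)) = ¬⇔¬ (λ { (inj₁ ()) ; (inj₂ ()) }) (~-irrefl refl)

  -- If K has no isolated vertex, the images are automatically disjoint: a
  -- common vertex would be adjacent to the image of a neighbour in K.
  disjointUnion-↪ : ∀ {K L} (e : K ↪ G) (f : L ↪ G) → (∀ u → ∃[ v ] Graph._~_ K v u) →
    (∀ u v → ¬ _↪_.to e u ~ _↪_.to f v) → disjointUnion K L ↪ G
  disjointUnion-↪ {K} {L} e f neighbour e≁f = record
    { to        = to ∘ splitAt (order K)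
    ; injective = λ {u} {v} eq → trans (sym (join-splitAt (order K) (order L) u))
        (trans (cong (join (order K) (order L)) (injective (splitAt (order K) u) (splitAt (order K) v) eq))
          (join-splitAt (order K) (order L) v))
    ; adjacent  = λ u v → adjacent (splitAt (order K) u) (splitAt (order K) v)
    }
    where
    module e = _↪_ e
    module f = _↪_ f

    to : Vertex K ⊎ Vertex L → Vertex G
    to = [ e.to , f.to ]′

    disjoint : ∀ u v → e.to u ≢ f.to v
    disjoint u v eq with w , w~u ← neighbour u =
      e≁f w v (subst (e.to w ~_) eq (Equivalence.to (e.adjacent w u) w~u))

    injective : ∀ x y → to x ≡ to y → x ≡ y
    injective (inj₁ u) (inj₁ v) eq = cong inj₁ (e.injective eq)
    injective (inj₁ u) (inj₂ v) eq = contradiction eq (disjoint u v)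
    injective (inj₂ u) (inj₁ v) eq = contradiction (sym eq) (disjoint v u)
    injective (inj₂ u) (inj₂ v) eq = cong inj₂ (f.injective eq)

    adjacent : ∀ x y → Pointwise (Graph._~_ K) (Graph._~_ L) x y ⇔ (to x ~ to y)
    adjacent (inj₁ u) (inj₁ v) = mk⇔ (λ { (inj₁ p) → Equivalence.to (e.adjacent u v) p })
      (inj₁ ∘ Equivalence.from (e.adjacent u v))
    adjacent (inj₁ u) (inj₂ v) = ¬⇔¬ (λ ()) (e≁f u v)
    adjacent (inj₂ u) (inj₁ v) = ¬⇔¬ (λ ()) (e≁f v u ∘ ~-sym)
    adjacent (inj₂ u) (inj₂ v) = mk⇔ (λ { (inj₂ p) → Equivalence.to (f.adjacent u v) p })
      (inj₂ ∘ Equivalence.from (f.adjacent u v))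

  2P₃-↪ : ∀ {x y z x′ y′ z′} →
    x ≢ z → x ~ y → z ~ y → ¬ x ~ z → x′ ≢ z′ → x′ ~ y′ → z′ ~ y′ → ¬ x′ ~ z′ →
    All (λ u → All (λ v → ¬ u ~ v) (x′ ∷ y′ ∷ z′ ∷ [])) (x ∷ y ∷ z ∷ []) →
    2P₃ ↪ G
  2P₃-↪ x≢z x~y z~y x≁z x′≢z′ x′~y′ z′~y′ x′≁z′ separate = disjointUnion-↪
    (path₃-↪ x≢z x~y z~y x≁z) (path₃-↪ x′≢z′ x′~y′ z′~y′ x′≁z′)
    (λ { zero             → suc zero , inj₂ refl
       ; (suc zero)       → zero , inj₁ refl
       ; (suc (suc zero)) → suc zero , inj₁ refl })
    (λ u v → lookup⁺ (lookup⁺ separate u) v)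

  -- Domination and common neighbours in claw-free graphs

  -- Domination relative to `S`, since after deletions only part of `A` remains dominated. The
  -- relation between `x` and `y` is the one passed to `subset-pigeonhole`.
  Dominates : (T S : Subset (order G)) → Set
  Dominates T S = ∀ x → x ∈ S → ∃[ y ] y ∈ T × (x ≡ y ⊎ x ~ y)

  dominating⇒dominates : ∀ {S T} → Dominating G T → Dominates T S
  dominating⇒dominates dom x _ with dom x
  ... | inj₁ x∈T             = x , x∈T , inj₁ refl
  ... | inj₂ (y , y∈T , x~y) = y , y∈T , inj₂ x~y

  -- No vertex of `S` equals `y` or is adjacent to it, so every dominating witness survives the
  -- deletion.
  dominates-delete : ∀ {S T y} → Dominates T S → y ∉ S → (∀ {x} → x ∈ S → ¬ x ~ y) →
    Dominates (T - y) S
  dominates-delete {S} {T} {y} dom y∉S S≁y x x∈S with dom x x∈S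
  ... | z , z∈T , xz = z , x∈p∧x≢y⇒x∈p-y z∈T (z≢y xz) , xz
    where
    z≢y : x ≡ z ⊎ x ~ z → z ≢ y
    z≢y (inj₁ refl) refl = y∉S x∈S
    z≢y (inj₂ x~z)  refl = S≁y x∈S x~z

  -- By the pigeonhole principle two vertices of `A` share a witness `b`. If `b` were one of them,
  -- it would equal the other or be adjacent to it, against distinctness or independence.
  common-neighbour : ∀ {A B} → Independent G A → ∣ B ∣ < ∣ A ∣ → Dominates B A →
    ∃[ a ] ∃[ a′ ] ∃[ b ] a ∈ A × a′ ∈ A × b ∈ B × a ≢ a′ × a ~ b × a′ ~ b
  common-neighbour indA B<A near with subset-pigeonhole B<A near
  ... | a , a′ , b , a∈A , a′∈A , b∈B , a≢a′ , inj₁ refl , inj₁ refl = contradiction refl a≢a′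
  ... | a , a′ , b , a∈A , a′∈A , b∈B , a≢a′ , inj₁ refl , inj₂ a′~b =
    contradiction a′~b (indA _ _ a′∈A a∈A)
  ... | a , a′ , b , a∈A , a′∈A , b∈B , a≢a′ , inj₂ a~b , inj₁ refl =
    contradiction a~b (indA _ _ a∈A a′∈A)
  ... | a , a′ , b , a∈A , a′∈A , b∈B , a≢a′ , inj₂ a~b , inj₂ a′~b =
    a , a′ , b , a∈A , a′∈A , b∈B , a≢a′ , a~b , a′~b

  module _ (claw-free : ¬ claw ↪ G) {A : Subset (order G)} (indA : Independent G A) where

    -- Otherwise `b` would be the centre of a claw with leaves `x`, `y`, `z`.
    no-third-neighbour : ∀ {b x y z} → x ∈ A → y ∈ A → x ≢ y → x ~ b → y ~ b →
      z ∈ A → z ≢ x → z ≢ y → ¬ z ~ b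
    no-third-neighbour {b} {x} {y} {z} x∈A y∈A x≢y x~b y~b z∈A z≢x z≢y z~b = claw-free
      (star-↪ b (x ∷ y ∷ z ∷ []) indA
        ((x≢y ∷ ≢-sym z≢x ∷ []) ∷ (≢-sym z≢y ∷ []) ∷ [] ∷ [])
        (x∈A ∷ y∈A ∷ z∈A ∷ [])
        (~-sym x~b ∷ ~-sym y~b ∷ ~-sym z~b ∷ []))

    A-x-y≁ : ∀ {b x y} → x ∈ A → y ∈ A → x ≢ y → x ~ b → y ~ b →
      ∀ {z} → z ∈ A - x - y → ¬ z ~ b
    A-x-y≁ x∈A y∈A x≢y x~b y~b z∈ = no-third-neighbour x∈A y∈A x≢y x~b y~b
      (p-x-y⊆p A z∈) (z∈p-x-y⇒z≢x A z∈) (z∈p-x-y⇒z≢y A z∈)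

    claw-free⇒2P₃-↪ : ∀ {B} → MaximalIndependent G B → 2 + ∣ B ∣ ≤ ∣ A ∣ → 2P₃ ↪ G
    claw-free⇒2P₃-↪ {B} maxB 2+B≤A
      with a₁ , a₂ , b , a₁∈A , a₂∈A , b∈B , a₁≢a₂ , a₁~b , a₂~b ←
             common-neighbour indA (<-≤-trans (n<1+n _) (≤-trans (n≤1+n _) 2+B≤A))
               (dominating⇒dominates (maximal⇒dominating G maxB))
      -- Deleting `b` preserves domination of `A - a₁ - a₂`: `b` is outside `A`, being adjacent to
      -- `a₁`, and by claw-freeness it has no neighbour left there.
      with a₃ , a₄ , b′ , a₃∈A′ , a₄∈A′ , b′∈B-b , a₃≢a₄ , a₃~b′ , a₄~b′ ←
             common-neighbour (λ u v u∈ v∈ → indA u v (p-x-y⊆p A u∈) (p-x-y⊆p A v∈))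
               (∣q-z∣<∣p-x-y∣ A B 2+B≤A a₁ a₂ b∈B)
               (dominates-delete (dominating⇒dominates (maximal⇒dominating G maxB))
                 (λ b∈A′ → indA _ _ a₁∈A (p-x-y⊆p A b∈A′) a₁~b)
                 (A-x-y≁ a₁∈A a₂∈A a₁≢a₂ a₁~b a₂~b))
      =
      let a₃∈A = p-x-y⊆p A a₃∈A′
          a₄∈A = p-x-y⊆p A a₄∈A′
          b≁ : ∀ {a} → a ∈ A - a₁ - a₂ → ¬ b ~ a
          b≁ = λ a∈A′ → A-x-y≁ a₁∈A a₂∈A a₁≢a₂ a₁~b a₂~b a∈A′ ∘ ~-sym
          b′≁ : ∀ {a} → a ∈ A → a₃ ≢ a → a₄ ≢ a → ¬ a ~ b′
          b′≁ = λ a∈A a₃≢a a₄≢a →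
            no-third-neighbour a₃∈A a₄∈A a₃≢a₄ a₃~b′ a₄~b′ a∈A (≢-sym a₃≢a) (≢-sym a₄≢a)
      in 2P₃-↪ a₁≢a₂ a₁~b a₂~b (indA _ _ a₁∈A a₂∈A) a₃≢a₄ a₃~b′ a₄~b′ (indA _ _ a₃∈A a₄∈A)
        -- Rows are `a₁`, `b`, `a₂` and columns `a₃`, `b′`, `a₄`. The middle entry uses that `b` and
        -- `b′` both lie in the independent set `B`.
        ( ( indA _ _ a₁∈A a₃∈A
          ∷ b′≁ a₁∈A (z∈p-x-y⇒z≢x A a₃∈A′) (z∈p-x-y⇒z≢x A a₄∈A′)
          ∷ indA _ _ a₁∈A a₄∈A ∷ [])
        ∷ (b≁ a₃∈A′ ∷ proj₁ maxB _ _ b∈B (p─q⊆p B ⁅ b ⁆ b′∈B-b) ∷ b≁ a₄∈A′ ∷ [])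
        ∷ ( indA _ _ a₂∈A a₃∈A
          ∷ b′≁ a₂∈A (z∈p-x-y⇒z≢y A a₃∈A′) (z∈p-x-y⇒z≢y A a₄∈A′)
          ∷ indA _ _ a₂∈A a₄∈A ∷ [])
        ∷ [])

mainTheorem10 : (G : Graph) → hereditaryGap G ≤ 1 ⇔ G isFreeOf (claw ∷ 2P₃ ∷ [])
mainTheorem10 G = mk⇔ to from
  where
  to : hereditaryGap G ≤ 1 → G isFreeOf (claw ∷ 2P₃ ∷ [])
  to h≤1 S iso = n≮n 1 (begin
    2                  ≤⟨ gap≥2 iso ⟩
    gap (induced G S)  ≤⟨ gap≤hereditaryGap G S ⟩
    hereditaryGap G    ≤⟨ h≤1 ⟩
    1                  ∎)
    where
    open ≤-Reasoning
    -- gap claw and gap 2P₃ evaluate to 2 during conversion checking.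
    gap≥2 : _ → 2 ≤ gap (induced G S)
    gap≥2 (here iso)         = gap-≅ iso
    gap≥2 (there (here iso)) = gap-≅ iso

  from : G isFreeOf (claw ∷ 2P₃ ∷ []) → hereditaryGap G ≤ 1
  from free = max≤v⁺ z≤n (All-map⁺ (List.universal gap≤1 (subsets (order G))))
    where
    gap≤1 : ∀ S → gap (induced G S) ≤ 1
    gap≤1 S = ≮⇒≥ λ 1<gap →
      let A , B , indA , maxB , gap≡ = gap-attained (induced G S) (≤-trans (s≤s z≤n) 1<gap)
          2+B≤A = 0<m≤n∸o⇒m+o≤n (s≤s z≤n) (≤-trans 1<gap (≤-reflexive gap≡))
          -- Freeness passes to `induced G S`, because an embedding into it composes to one into
          -- `G`.
          claw-free = isFreeOf⇒¬↪ free (here refl) ∘ ↪-induced G S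
          2P₃-free = isFreeOf⇒¬↪ free (there (here refl)) ∘ ↪-induced G S
      in 2P₃-free (claw-free⇒2P₃-↪ claw-free indA maxB 2+B≤A)
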